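{- Let $K$ be an algebraic number field with a power integral basis, and let $O_K$ be its ring of algebraic integers. Let $m$ be a positive integer and let $\alpha_1,\ldots,\alpha_k\in O_K$ and nonzero $\beta_1,\ldots,\beta_k\in O_K$ be such that the system $\{\alpha_s+\beta_sO_K\}_{s=1}^k$ forms an $m$-cover of $O_K$. Let $\omega_1,\ldots,\omega_k\in O_K$. Then for any $\mu\in K$, the set $$\Big\{I\subseteq\{1,\ldots,k\}:\ \sum_{s\in I}\frac{\omega_s}{\beta_s}\in\mu+O_K\Big\}$$ is either empty or has at least $2^m$ elements.
   Context: For $\alpha,\beta\in O_K$, $\alpha+\beta O_K=\{\alpha+\beta\omega:\ \omega\in O_K\}$. The system $\{\alpha_s+\beta_sO_K\}_{s=1}^k$ is an $m$-cover of $O_K$ if $|\{1\le s\le k:\ x\in\alpha_s+\beta_sO_K\}|\ge m$ for all $x\in O_K$. A number field $K$ of degree $n$ has a power integral basis if there is $\gamma\in O_K$ such that $1,\gamma,\ldots,\gamma^{n-1}$ is a $\mathbb{Z}$-basis of $O_K$. -}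

module Defs where

open import Data.Nat using (ℕ; zero; suc; _≤_)
open import Data.Integer using (ℤ)
open import Data.Rational using (ℚ; 0ℚ; 1ℚ; _+_; _*_; -_; _-_; _/_)
open import Data.Fin using (Fin; zero; suc; fromℕ; inject₁)
open import Data.Fin.Subset using (Subset; _∈_; ∣_∣)
open import Data.List using (List; foldr; foldl; allFin)
open import Data.Vec using (lookup)
open import Data.Bool using (if_then_else_)
open import Data.Product using (Σ; ∃; _×_)
open import Relation.Binary.PropositionalEquality using (_≡_)
open import Relation.Nullary using (¬_)

-- Model: K = ℚ[x]/(f), f = x^(suc d) + Σ_{i ≤ d} c i x^i monic in ℤ[x],
-- γ = class of x.  An element of K is its coordinate vector w.r.t. 1, γ, …, γ^d.

ℤ→ℚ : ℤ → ℚ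
ℤ→ℚ z = z / 1

Elem : ℕ → Set
Elem d = Fin (suc d) → ℚ

module _ {d : ℕ} where

  zeroK : Elem d
  zeroK _ = 0ℚ

  oneK : Elem d
  oneK zero    = 1ℚ
  oneK (suc _) = 0ℚ

  addK : Elem d → Elem d → Elem d
  addK a b i = a i + b i

  scaleK : ℚ → Elem d → Elem d
  scaleK q a i = q * a i

  _≈K_ : Elem d → Elem d → Set
  a ≈K b = ∀ i → a i ≡ b i

  -- multiplication by γ, reducing with γ^(suc d) = - Σ c i γ^i
  mulγ : (Fin (suc d) → ℤ) → Elem d → Elem d
  mulγ c a zero    = - (ℤ→ℚ (c zero) * a (fromℕ d))
  mulγ c a (suc j) = a (inject₁ j) - ℤ→ℚ (c (suc j)) * a (fromℕ d)

  -- a * b = Σ_i b_i γ^i a   (Horner in γ)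
  mulK : (Fin (suc d) → ℤ) → Elem d → Elem d → Elem d
  mulK c a b = foldr (λ i r → addK (mulγ c r) (scaleK (b i) a)) zeroK
                     (allFin (suc d))

  IsField : (Fin (suc d) → ℤ) → Set
  IsField c = ∀ (a : Elem d) → ¬ (a ≈K zeroK) → Σ (Elem d) (λ b → mulK c a b ≈K oneK)

  -- value at a of the monic polynomial X^(length cs) + cs₀ X^(length cs - 1) + … (highest first)
  evalMonic : (Fin (suc d) → ℤ) → List ℤ → Elem d → Elem d
  evalMonic c cs a = foldl (λ r z → addK (mulK c r a) (scaleK (ℤ→ℚ z) oneK)) oneK cs

  IsAlgInt : (Fin (suc d) → ℤ) → Elem d → Set
  IsAlgInt c a = Σ (List ℤ) (λ cs → evalMonic c cs a ≈K zeroK)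

  InZγ : Elem d → Set
  InZγ a = ∀ i → Σ ℤ (λ z → a i ≡ ℤ→ℚ z)

  PowerIntegralBasis : (Fin (suc d) → ℤ) → Set
  PowerIntegralBasis c = ∀ (a : Elem d) → (IsAlgInt c a → InZγ a) × (InZγ a → IsAlgInt c a)

  InCoset : (Fin (suc d) → ℤ) → Elem d → Elem d → Elem d → Set
  InCoset c x α β = Σ (Elem d) (λ w → IsAlgInt c w × (x ≈K addK α (mulK c β w)))

  IsMCover : (Fin (suc d) → ℤ) → ℕ → {k : ℕ} → (Fin k → Elem d) → (Fin k → Elem d) → Set
  IsMCover c m {k} α β =
    ∀ (x : Elem d) → IsAlgInt c x →
      Σ (Subset k) (λ J → (m ≤ ∣ J ∣) × (∀ s → s ∈ J → InCoset c x (α s) (β s)))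

  sumOver : {k : ℕ} → Subset k → (Fin k → Elem d) → Elem d
  sumOver {k} I q = foldr (λ s r → if lookup I s then addK (q s) r else r) zeroK
                          (allFin k)

  InShiftedOK : (Fin (suc d) → ℤ) → Elem d → Elem d → Set
  InShiftedOK c μ y = Σ (Elem d) (λ w → IsAlgInt c w × (y ≈K addK μ w))

{-# OPTIONS --safe #-}

-- For x ∈ ℤ[γ] let χ_x be the character y ↦ exp(2πi · top (x y)) of K / ℤ[γ], where top is the
-- coefficient of γ^d, and let g_I = Σ_{s ∈ I} ω_s / β_s.  If x ∈ α_s + β_s O_K then
-- χ_x(ω_s / β_s) = χ_{α_s}(ω_s / β_s) =: ζ_s, a root of unity independent of x.  Hence, as a
-- multilinear polynomial in T,
--   Π_s (1 − ζ_s⁻¹ χ_x(ω_s / β_s) T_s) = Σ_I ± ζ_I⁻¹ χ_x(g_I) T^I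
-- vanishes to order m at T = (1, …, 1).  Averaging against χ_x(−μ) over x mod N leaves exactly the
-- monomials T^I with g_I ∈ μ + O_K, and a nonzero multilinear polynomial vanishing to order m at
-- (1, …, 1) has at least 2^m monomials.
--
-- Instead of exp(2πi t / N) one uses θ(u + t) for an N-periodic θ : ℤ → ℤ with θ(0) = 1 and
-- Σ_{j < N} θ(u + j a) = 0 for all u whenever N ∤ a: the coefficients then lie in an abelian
-- group, which is all that the counting of monomials needs.
module Submission where

open import Defs
open import Data.Nat as ℕ using (ℕ; zero; suc; NonZero; _≤_; _<_; _^_; z≤n; s≤s)
import Data.Nat.Properties as ℕ
import Data.Nat.Divisibility as ℕ
open import Data.Nat.GCD using (GCD; mkGCD; module Bézout)
open import Data.Nat.ListAction using (product)
open import Data.Nat.Primality using (Prime; prime?; euclidsLemma; ¬prime[1]; prime⇒nonZero)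
open import Data.Nat.Primality.Factorisation using (factorise)
open import Data.Integer as ℤ using (ℤ; +_; -[1+_]; 0ℤ; 1ℤ; _+_; _*_; _-_; -_)
import Data.Integer.Properties as ℤ
open import Data.Integer.Divisibility.Signed
open import Data.Integer.Tactic.RingSolver using (solve-∀)
open import Data.Rational as ℚ using (ℚ; 0ℚ; 1ℚ)
import Data.Rational.Properties as ℚ
open import Data.Rational.Solver using (module +-*-Solver)
open import Data.Rational.Unnormalised as ℚᵘ using (mkℚᵘ; *≡*)
import Data.Rational.Unnormalised.Properties as ℚᵘ
open import Data.Bool using (if_then_else_)
open import Data.Fin as Fin using (Fin; zero; suc; toℕ; fromℕ; inject₁)
open import Data.Fin.Properties using (combine-remQuot; toℕ-inject₁; toℕ-fromℕ<; toℕ<n)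
open import Data.Fin.Relation.Unary.Top using (view; ‵fromℕ; ‵inject₁)
open import Data.Fin.Subset using (Subset; inside; outside; ∣_∣; _∈_)
open import Data.Fin.Subset.Properties using (anySubset?)
open import Data.List using ([]; _∷_; tabulate; foldr)
open import Data.List.Relation.Unary.All using (_∷_)
open import Data.Vec as Vec using (Vec; []; _∷_; here; there)
open import Data.Vec.Properties using (∷-injectiveʳ)
open import Data.Product using (Σ; ∃-syntax; _×_; _,_; proj₁; proj₂)
open import Data.Sum using (inj₁; inj₂)
open import Data.Unit using (⊤; tt)
open import Function using (_∘_)
open import Function.Definitions using (Injective)
open import Relation.Nullary using (¬_; yes; no; ¬?; contradiction; _×-dec_; decidable-stable)
open import Relation.Binary.PropositionalEquality
open +-*-Solver using (solve; _:+_; _:*_; _:-_; :-_; _:=_; con)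
open ≡-Reasoning

private variable
  m n k : ℕ

+-interchange : ∀ a b c d → (a + b) + (c + d) ≡ (a + c) + (b + d)
+-interchange = solve-∀

+-swap : ∀ a b c → a + b + c ≡ a + c + b
+-swap = solve-∀

-- Finite sums

∑ : ℕ → (ℕ → ℤ) → ℤ
∑ zero    f = 0ℤ
∑ (suc n) f = f n + ∑ n f

∑-cong : ∀ n {f g : ℕ → ℤ} → (∀ j → f j ≡ g j) → ∑ n f ≡ ∑ n g
∑-cong zero    f≗g = refl
∑-cong (suc n) f≗g = cong₂ _+_ (f≗g n) (∑-cong n f≗g)

∑-zero : ∀ n → ∑ n (λ _ → 0ℤ) ≡ 0ℤ
∑-zero zero    = refl
∑-zero (suc n) = trans (ℤ.+-identityˡ _) (∑-zero n)

∑-distrib-+ : ∀ n (f g : ℕ → ℤ) → ∑ n (λ j → f j + g j) ≡ ∑ n f + ∑ n g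
∑-distrib-+ zero    f g = refl
∑-distrib-+ (suc n) f g = trans (cong (_+_ (f n + g n)) (∑-distrib-+ n f g))
  (+-interchange (f n) (g n) (∑ n f) (∑ n g))

∑-neg : ∀ n (f : ℕ → ℤ) → ∑ n (λ j → - f j) ≡ - ∑ n f
∑-neg zero    f = refl
∑-neg (suc n) f = trans (cong (_+_ (- f n)) (∑-neg n f)) (sym (ℤ.neg-distrib-+ (f n) (∑ n f)))

∑-swap : ∀ n m (f : ℕ → ℕ → ℤ) → ∑ n (λ i → ∑ m (f i)) ≡ ∑ m (λ j → ∑ n (λ i → f i j))
∑-swap zero    m f = sym (∑-zero m)
∑-swap (suc n) m f = trans (cong (_+_ (∑ m (f n))) (∑-swap n m f))
  (sym (∑-distrib-+ m (f n) (λ j → ∑ n (λ i → f i j))))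

∑-shift : ∀ n (f : ℕ → ℤ) → ∑ n (f ∘ suc) + f 0 ≡ f n + ∑ n f
∑-shift zero    f = ℤ.+-comm 0ℤ (f 0)
∑-shift (suc n) f = trans (ℤ.+-assoc (f (suc n)) (∑ n (f ∘ suc)) (f 0))
  (cong (_+_ (f (suc n))) (∑-shift n f))

-- Periods of functions on ℤ

Period : (ℤ → ℤ) → ℤ → Set
Period h a = ∀ t → h (t + a) ≡ h t

period-+ : ∀ {h a b} → Period h a → Period h b → Period h (a + b)
period-+ {h} {a} {b} pa pb t =
  trans (cong h (sym (ℤ.+-assoc t a b))) (trans (pb (t + a)) (pa t))

period-neg : ∀ {h a} → Period h a → Period h (- a)
period-neg {h} {a} pa t =
  trans (sym (pa (t - a))) (cong h (cancel t a))
  where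
  cancel : ∀ t a → t - a + a ≡ t
  cancel = solve-∀

period-0 : ∀ {h} → Period h 0ℤ
period-0 {h} t = cong h (ℤ.+-identityʳ t)

period-∣ : ∀ {h a b} → a ∣ b → Period h a → Period h b
period-∣ {h} {a} (divides q refl) pa = multiple q
  where
  multipleℕ : ∀ n → Period h (+ n * a)
  multipleℕ zero    = period-0
  multipleℕ (suc n) =
    subst (Period h) (sym (ℤ.suc-* (+ n) a)) (period-+ {h} {a} pa (multipleℕ n))

  multiple : ∀ z → Period h (z * a)
  multiple (+ n)    = multipleℕ n
  multiple -[1+ n ] = subst (Period h) (ℤ.neg-distribˡ-* (+ suc n) a)
    (period-neg {h} {+ suc n * a} (multipleℕ (suc n)))

period-multiple : ∀ {h} z {a} → Period h (+ a) → Period h (+ (z ℕ.* a))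
period-multiple z = period-∣ (divides (+ z) (ℤ.pos-* z _))

period-∸ : ∀ {h a b d} → d ℕ.+ b ≡ a → Period h (+ a) → Period h (+ b) → Period h (+ d)
period-∸ {h} {a} {b} {d} refl pa pb = subst (Period h)
  (trans (cong (_- + b) (ℤ.pos-+ d b)) (cancel (+ d) (+ b)))
  (period-+ {h} {+ a} pa (period-neg {h} {+ b} pb))
  where
  cancel : ∀ a b → a + b - b ≡ a
  cancel = solve-∀

-- The periods of `h` form a subgroup of ℤ. Bézout's identity comes over ℕ, in the form d + y n = x
-- m or d + x m = y n, and either form exhibits d as a difference of two periods.
period-gcd : ∀ {h m n d} → GCD m n d → Period h (+ m) → Period h (+ n) → Period h (+ d)
period-gcd {h} g pm pn with Bézout.identity g
... | Bézout.+- x y eq = period-∸ {h} eq (period-multiple {h} x pm) (period-multiple {h} y pn)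
... | Bézout.-+ x y eq = period-∸ {h} eq (period-multiple {h} y pn) (period-multiple {h} x pm)

-- An integer-valued substitute for a primitive N-th root of unity

-- With τ the unit shift, this says that `f` lies in the image of 1 - τ^r on N-periodic functions. A
-- sum of `f` is then a difference of two sums of `g`, which cancel as soon as the sums of `g` have
-- period r.
Difference : ℕ → (ℤ → ℤ) → ℕ → Set
Difference N f r = ∃[ g ] Period g (+ N) × (∀ t → f t ≡ g t - g (t + + r))

-- R is the product of the primes p < b dividing N, and f = Π (1 − τ^{N/p}) δ over these p, where
-- τ is the unit shift and δ the indicator of Nℤ; so f lives on the multiples of N / R.
record Sieve (N b : ℕ) : Set where
  field
    f          : ℤ → ℤ
    periodic   : Period f (+ N)
    f0≡1       : f 0ℤ ≡ 1ℤ
    R          : ℕ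
    primes<b   : ∀ {p} → Prime p → p ℕ.∣ R → p < b
    support    : ∀ t → ¬ (+ N ∣ + R * t) → f t ≡ 0ℤ
    difference : ∀ {p r} → Prime p → p < b → N ≡ r ℕ.* p → Difference N f r

module _ (N : ℕ) .{{_ : NonZero N}} where

  δ : ℤ → ℤ
  δ t with + N ∣? t
  ... | yes _ = 1ℤ
  ... | no  _ = 0ℤ

  δ-yes : ∀ {t} → + N ∣ t → δ t ≡ 1ℤ
  δ-yes {t} d with + N ∣? t
  ... | yes _ = refl
  ... | no ¬d = contradiction d ¬d

  δ-no : ∀ {t} → ¬ (+ N ∣ t) → δ t ≡ 0ℤ
  δ-no {t} ¬d with + N ∣? t
  ... | yes d = contradiction d ¬d
  ... | no  _ = refl

  δ-periodic : Period δ (+ N)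
  δ-periodic t with + N ∣? t
  ... | yes d = δ-yes (∣m∣n⇒∣m+n d ∣-refl)
  ... | no ¬d = δ-no (λ d → ¬d (∣m+n∣n⇒∣m d ∣-refl))

  sieve : ∀ b → Sieve N b
  sieve zero = record
    { f          = δ
    ; periodic   = δ-periodic
    ; f0≡1       = δ-yes (divides 0ℤ refl)
    ; R          = 1
    ; primes<b   = λ pp p∣1 → contradiction (subst Prime (ℕ.∣1⇒≡1 p∣1) pp) ¬prime[1]
    ; support    = λ t N∤t → δ-no (N∤t ∘ subst (+ N ∣_) (sym (ℤ.*-identityˡ t)))
    ; difference = λ _ ()
    }
  sieve (suc b) with prime? b ×-dec (b ℕ.∣? N)
  ... | no ¬pd = record
    { f          = f
    ; periodic   = periodic
    ; f0≡1       = f0≡1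
    ; R          = R
    ; primes<b   = λ pp p∣R → ℕ.m≤n⇒m≤1+n (primes<b pp p∣R)
    ; support    = support
    ; difference = λ {p} {r} pp p<1+b N≡rp → difference pp
        (ℕ.≤∧≢⇒< (ℕ.s≤s⁻¹ p<1+b) λ where refl → ¬pd (pp , ℕ.divides r N≡rp)) N≡rp
    }
    where open Sieve (sieve b)
  ... | yes (pb , ℕ.divides s N≡sb) = record
    { f          = f′
    ; periodic   = λ t → cong₂ _-_ (periodic t) (shifted-periodic (+ s) periodic t)
    ; f0≡1       = cong₂ _-_ f0≡1 (support (0ℤ + + s) outside-support)
    ; R          = b ℕ.* R
    ; primes<b   = primes<1+b
    ; support    = support′
    ; difference = difference′
    }
    where
    open Sieve (sieve b)

    f′ : ℤ → ℤ
    f′ t = f t - f (t + + s)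

    shifted-periodic : ∀ {g : ℤ → ℤ} a → Period g (+ N) → Period (λ t → g (t + a)) (+ N)
    shifted-periodic {g} a pg t = trans (cong g (+-swap t (+ N) a)) (pg (t + a))

    instance
      s≢0 : NonZero s
      s≢0 = ℕ.≢-nonZero λ where refl → ℕ.≢-nonZero⁻¹ N N≡sb

    -- From N = s b, the relation N ∣ R s would give b ∣ R, although all primes dividing R are below
    -- b. This is what keeps the value at 0 equal to 1: the subtracted term vanishes there.
    outside-support : ¬ (+ N ∣ + R * (0ℤ + + s))
    outside-support N∣ = ℕ.<-irrefl refl (primes<b pb
      (ℕ.*-cancelˡ-∣ s (subst₂ ℕ._∣_ N≡sb (ℕ.*-comm R s)
        (∣⇒∣ᵤ {+ N} {+ (R ℕ.* s)} (subst (+ N ∣_) (sym (ℤ.pos-* R s)) N∣)))))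

    primes<1+b : ∀ {p} → Prime p → p ℕ.∣ b ℕ.* R → p < suc b
    primes<1+b pp p∣bR with euclidsLemma b R pp p∣bR
    ... | inj₁ p∣b = s≤s (ℕ.∣⇒≤ {{prime⇒nonZero pb}} p∣b)
    ... | inj₂ p∣R = ℕ.m≤n⇒m≤1+n (primes<b pp p∣R)

    -- N ∣ R t implies N ∣ b R t. N ∣ R (t + s) implies the same, because b R (t + s) = b R t + R (s
    -- b) and s b = N.
    support′ : ∀ t → ¬ (+ N ∣ + (b ℕ.* R) * t) → f′ t ≡ 0ℤ
    support′ t N∤ = cong₂ _-_ (support t not-t) (support (t + + s) not-t+s)
      where
      not-t : ¬ (+ N ∣ + R * t)
      not-t N∣ = N∤ (subst (+ N ∣_)
        (trans (sym (ℤ.*-assoc (+ b) (+ R) t)) (cong (_* t) (sym (ℤ.pos-* b R))))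
        (∣n⇒∣m*n (+ b) N∣))
      expand : ∀ b r t s → b * (r * (t + s)) ≡ b * r * t + r * (s * b)
      expand = solve-∀
      not-t+s : ¬ (+ N ∣ + R * (t + + s))
      not-t+s N∣ = N∤ (∣m+n∣n⇒∣m
        (subst (+ N ∣_)
          (trans (expand (+ b) (+ R) t (+ s))
            (cong₂ _+_ (cong (_* t) (sym (ℤ.pos-* b R)))
                       (cong (+ R *_) (trans (sym (ℤ.pos-* s b)) (cong +_ (sym N≡sb))))))
          (∣n⇒∣m*n (+ b) N∣))
        (∣n⇒∣m*n (+ R) ∣-refl))

    -- For the new prime p = b the old `f` is itself the witness. For a smaller prime the operators
    -- 1 - τ^s and 1 - τ^r commute, so applying 1 - τ^s to the old witness gives a new one.
    difference′ : ∀ {p r} → Prime p → p < suc b → N ≡ r ℕ.* p → Difference N f′ r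
    difference′ {p} {r} pp p<1+b N≡rp with p ℕ.≟ b
    ... | yes refl = f , periodic , λ t → cong (λ s → f t - f (t + + s))
          (ℕ.*-cancelʳ-≡ s r p {{prime⇒nonZero pp}} (trans (sym N≡sb) N≡rp))
    ... | no p≢b with difference pp (ℕ.≤∧≢⇒< (ℕ.s≤s⁻¹ p<1+b) p≢b) N≡rp
    ... | g , pg , f≗ =
        (λ t → g t - g (t + + s))
      , (λ t → cong₂ _-_ (pg t) (shifted-periodic (+ s) pg t))
      , λ t → trans (cong₂ _-_ (f≗ t) (f≗ (t + + s)))
          (trans (interchange (g t) (g (t + + r)) (g (t + + s)) (g (t + + s + + r)))
            (cong (λ u → g t - g (t + + s) - (g (t + + r) - g u)) (+-swap t (+ s) (+ r))))
      where
      interchange : ∀ a b c d → a - b - (c - d) ≡ a - c - (b - d)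
      interchange = solve-∀

-- Orthogonality: vanishing sums along arithmetic progressions mod N

prime-divisor : ∀ n .{{_ : NonZero n}} → n ≢ 1 → ∃[ p ] Prime p × p ℕ.∣ n
prime-divisor n n≢1 with factorise n
... | record { factors = [] ; isFactorisation = n≡1 } = contradiction n≡1 n≢1
... | record { factors = p ∷ ps ; isFactorisation = n≡ ; factorsPrime = pp ∷ _ } =
  p , pp , ℕ.divides (product ps) (trans n≡ (ℕ.*-comm p (product ps)))

-- Always N terms, whatever the order of `a` mod N: each point of the orbit is counted equally
-- often, which does not affect vanishing.
orbitSum : ℕ → ℤ → (ℤ → ℤ) → ℤ → ℤ
orbitSum N a h t = ∑ N (λ j → h (t + + j * a))

module _ {N : ℕ} where

  -- Shifting by `a` advances the index by one. The term gained has index N and the term lost has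
  -- index 0; they agree because N a is a period of `h`.
  orbitSum-period : ∀ {h} a → Period h (+ N) → Period (orbitSum N a h) a
  orbitSum-period {h} a ph t = begin
    ∑ N (λ j → h (t + a + + j * a))                  ≡⟨ ∑-cong N (λ j → cong h (step t a j)) ⟩
    ∑ N (F ∘ suc)                                    ≡⟨ insert (∑ N (F ∘ suc)) (F 0) ⟩
    ∑ N (F ∘ suc) + F 0 - F 0                        ≡⟨ cong (_- F 0) (∑-shift N F) ⟩
    F N + ∑ N F - F 0                                ≡⟨ cong (λ z → z + ∑ N F - F 0) FN≡F0 ⟩
    F 0 + ∑ N F - F 0                                ≡⟨ cancel (F 0) (∑ N F) ⟩
    ∑ N F                                            ∎
    where
    F : ℕ → ℤ
    F j = h (t + + j * a)
    step : ∀ t a j → t + a + + j * a ≡ t + + suc j * a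
    step t a j = trans (ℤ.+-assoc t a (+ j * a)) (cong (_+_ t) (sym (ℤ.suc-* (+ j) a)))
    insert : ∀ x y → x ≡ x + y - y
    insert = solve-∀
    cancel : ∀ x y → x + y - x ≡ y
    cancel = solve-∀
    FN≡F0 : F N ≡ F 0
    FN≡F0 = trans (period-∣ {h} (∣m⇒∣m*n {+ N} a ∣-refl) ph t)
      (sym (period-∣ {h} (divides 0ℤ refl) ph t))

  orbitSum-period-N : ∀ {h} a → Period h (+ N) → Period (orbitSum N a h) (+ N)
  orbitSum-period-N {h} a ph t = ∑-cong N λ j →
    trans (cong h (+-swap t (+ N) (+ j * a))) (ph (t + + j * a))

  -- The orbit sum S of `g` has periods N and a, hence d and its multiple r. The orbit sum of `f` is
  -- S(t) - S(t + r).
  orbitSum-difference : ∀ {f r d} a → Difference N f r → GCD N ℤ.∣ a ∣ d → d ℕ.∣ r →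
                        ∀ t → orbitSum N a f t ≡ 0ℤ
  orbitSum-difference {f} {r} {d} a (g , pg , f≗) gcd d∣r t = begin
    ∑ N (λ j → f (t + + j * a))                                        ≡⟨ ∑-cong N split ⟩
    ∑ N (λ j → g (t + + j * a) + - g (t + + r + + j * a))
      ≡⟨ ∑-distrib-+ N (λ j → g (t + + j * a)) (λ j → - g (t + + r + + j * a)) ⟩
    S t + ∑ N (λ j → - g (t + + r + + j * a))                          ≡⟨ cong (_+_ (S t)) (∑-neg N (λ j → g (t + + r + + j * a))) ⟩
    S t - S (t + + r)                                                  ≡⟨ cong (_-_ (S t)) (period-r t) ⟩
    S t - S t                                                          ≡⟨ ℤ.+-inverseʳ (S t) ⟩
    0ℤ                                                                 ∎
    where
    S : ℤ → ℤ
    S = orbitSum N a g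
    split : ∀ j → f (t + + j * a) ≡ g (t + + j * a) - g (t + + r + + j * a)
    split j = trans (f≗ _) (cong (λ u → g (t + + j * a) - g u) (+-swap t (+ j * a) (+ r)))
    period-r : Period S (+ r)
    period-r = period-∣ {S} (∣ᵤ⇒∣ {+ d} {+ r} d∣r)
      (period-gcd {S} gcd (orbitSum-period-N a pg)
        (period-∣ {S} (m∣∣m∣ {a}) (orbitSum-period a pg)))

record PrimitiveKernel (N : ℕ) : Set where
  field
    θ          : ℤ → ℤ
    periodic   : Period θ (+ N)
    θ0≡1       : θ 0ℤ ≡ 1ℤ
    orthogonal : ∀ a → ¬ (+ N ∣ a) → ∀ t → orbitSum N a θ t ≡ 0ℤ

primitiveKernel : ∀ N .{{_ : NonZero N}} → PrimitiveKernel N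
primitiveKernel N = record
  { θ = f ; periodic = periodic ; θ0≡1 = f0≡1 ; orthogonal = orthogonal }
  where
  -- The bound is `suc N`, so that every prime divisor of N, possibly N itself, has been sieved.
  open Sieve (sieve N (suc N))

  -- Let d = gcd(N, a) and q = N / d. Since N does not divide a, q is not 1 and has a prime factor
  -- p. Then r = N / p is a multiple of d, and `f` is a difference along r.
  orthogonal : ∀ a → ¬ (+ N ∣ a) → ∀ t → orbitSum N a f t ≡ 0ℤ
  orthogonal a N∤a with mkGCD N ℤ.∣ a ∣
  ... | d , gcd with GCD.commonDivisor gcd
  ... | ℕ.divides q N≡qd , d∣a with prime-divisor q {{q≢0}} q≢1
    where
    q≢0 : NonZero q
    q≢0 = ℕ.≢-nonZero λ where refl → ℕ.≢-nonZero⁻¹ N N≡qd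
    q≢1 : q ≢ 1
    q≢1 refl = N∤a (∣ᵤ⇒∣ (subst (ℕ._∣ _) (sym (trans N≡qd (ℕ.*-identityˡ d))) d∣a))
  ... | p , pp , ℕ.divides s q≡sp =
    orbitSum-difference a
      (difference pp (s≤s (ℕ.∣⇒≤ (ℕ.divides (s ℕ.* d) N≡sdp))) N≡sdp) gcd (ℕ.divides s refl)
    where
    N≡sdp : N ≡ s ℕ.* d ℕ.* p
    N≡sdp = begin
      N               ≡⟨ N≡qd ⟩
      q ℕ.* d         ≡⟨ cong (ℕ._* d) q≡sp ⟩
      s ℕ.* p ℕ.* d   ≡⟨ ℕ.*-assoc s p d ⟩
      s ℕ.* (p ℕ.* d) ≡⟨ cong (s ℕ.*_) (ℕ.*-comm p d) ⟩
      s ℕ.* (d ℕ.* p) ≡⟨ ℕ.*-assoc s d p ⟨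
      s ℕ.* d ℕ.* p   ∎

-- Multilinear polynomials vanishing to high order

-- a lists the coefficients of a multilinear polynomial in T₁, …, T_k, which vanishes to order m
-- at T = (1, …, 1).
Vanish : ℕ → ∀ {k} → (Subset k → ℤ) → Set
Vanish zero    a         = ⊤
Vanish (suc m) {zero}  a = a [] ≡ 0ℤ
Vanish (suc m) {suc k} a =
  Vanish (suc m) (λ I → a (outside ∷ I) + a (inside ∷ I)) × Vanish m (λ I → a (inside ∷ I))

vanish-cong : ∀ m {k} {a b : Subset k → ℤ} → (∀ I → a I ≡ b I) → Vanish m a → Vanish m b
vanish-cong zero            a≗b _        = tt
vanish-cong (suc m) {zero}  a≗b v        = trans (sym (a≗b [])) v
vanish-cong (suc m) {suc k} a≗b (va , v) =
    vanish-cong (suc m) (λ I → cong₂ _+_ (a≗b (outside ∷ I)) (a≗b (inside ∷ I))) va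
  , vanish-cong m (λ I → a≗b (inside ∷ I)) v

vanish-0 : ∀ m {k} → Vanish m {k} (λ _ → 0ℤ)
vanish-0 zero            = tt
vanish-0 (suc m) {zero}  = refl
vanish-0 (suc m) {suc k} = vanish-0 (suc m) , vanish-0 m

vanish-+ : ∀ m {k} {a b : Subset k → ℤ} → Vanish m a → Vanish m b → Vanish m (λ I → a I + b I)
vanish-+ zero            _ _ = tt
vanish-+ (suc m) {zero}  va vb = cong₂ _+_ va vb
vanish-+ (suc m) {suc k} {a} {b} (va , va′) (vb , vb′) =
    vanish-cong (suc m)
      (λ I → +-interchange (a (outside ∷ I)) (a (inside ∷ I)) (b (outside ∷ I)) (b (inside ∷ I)))
      (vanish-+ (suc m) va vb)
  , vanish-+ m va′ vb′

vanish-neg : ∀ m {k} {a : Subset k → ℤ} → Vanish m a → Vanish m (λ I → - a I)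
vanish-neg zero            _ = tt
vanish-neg (suc m) {zero}  v = cong -_ v
vanish-neg (suc m) {suc k} {a} (va , v) =
    vanish-cong (suc m) (λ I → ℤ.neg-distrib-+ (a (outside ∷ I)) (a (inside ∷ I)))
      (vanish-neg (suc m) va)
  , vanish-neg m v

vanish-pred : ∀ m {k} {a : Subset k → ℤ} → Vanish (suc m) a → Vanish m a
vanish-pred zero            _ = tt
vanish-pred (suc m) {zero}  v = v
vanish-pred (suc m) {suc k} (va , v) = vanish-pred (suc m) va , vanish-pred m v

vanish-≤ : ∀ {m n k} {a : Subset k → ℤ} → m ≤ n → Vanish n a → Vanish m a
vanish-≤ {m} m≤n = descend (ℕ.≤⇒≤′ m≤n)
  where
  descend : ∀ {n k} {a : Subset k → ℤ} → m ℕ.≤′ n → Vanish n a → Vanish m a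
  descend (ℕ.≤′-reflexive refl) v = v
  descend {suc n} (ℕ.≤′-step m≤′n) v = descend m≤′n (vanish-pred n v)

-- With U = T₁ - 1, the polynomial a₀ + a₁ T₁ is (a₀ + a₁) + a₁ U, which is the decomposition behind
-- `Vanish`: the factor U contributes one order. Here a₁ has even one order more than required.
vanish-∷ : ∀ m {k} {a : Subset (suc k) → ℤ} → Vanish m (λ I → a (outside ∷ I)) →
           Vanish m (λ I → a (inside ∷ I)) → Vanish m a
vanish-∷ zero    _  _  = tt
vanish-∷ (suc m) v₀ v₁ = vanish-+ (suc m) v₀ v₁ , vanish-pred m v₁

-- Counting the monomials of a multilinear polynomial

ManySubsets : ℕ → ∀ {k} → (Subset k → Set) → Set
ManySubsets m {k} P = Σ (Fin (2 ^ m) → Subset k) λ F → Injective _≡_ _≡_ F × (∀ j → P (F j))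

many-map : ∀ m {P Q : Subset k → Set} → (∀ I → P I → Q I) → ManySubsets m P → ManySubsets m Q
many-map m f (F , F-inj , p) = F , F-inj , λ j → f (F j) (p j)

many-∷ : ∀ m s (P : Subset (suc k) → Set) → ManySubsets m (λ I → P (s ∷ I)) → ManySubsets m P
many-∷ m s P (F , F-inj , p) = (s ∷_) ∘ F , F-inj ∘ ∷-injectiveʳ , p

-- An index below 2 · 2^m splits into a bit and an index below 2^m. The bit selects the half, and
-- subsets from different halves differ in their first entry.
many-both : ∀ m (P : Subset (suc k) → Set) → ManySubsets m (λ I → P (outside ∷ I)) →
            ManySubsets m (λ I → P (inside ∷ I)) → ManySubsets (suc m) P
many-both {k} m P (F , F-inj , p) (G , G-inj , q) = H ∘ split , injective , H-P ∘ split
  where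
  split : Fin (2 ^ suc m) → Fin 2 × Fin (2 ^ m)
  split = Fin.remQuot {2} (2 ^ m)

  H : Fin 2 × Fin (2 ^ m) → Subset (suc k)
  H (zero     , j) = outside ∷ F j
  H (suc zero , j) = inside ∷ G j

  H-P : ∀ i → P (H i)
  H-P (zero     , j) = p j
  H-P (suc zero , j) = q j

  H-injective : ∀ i j → H i ≡ H j → i ≡ j
  H-injective (zero     , i) (zero     , j) eq = cong (zero ,_) (F-inj (∷-injectiveʳ eq))
  H-injective (suc zero , i) (suc zero , j) eq = cong (suc zero ,_) (G-inj (∷-injectiveʳ eq))
  H-injective (zero     , i) (suc zero , j) ()
  H-injective (suc zero , i) (zero     , j) ()

  injective : Injective _≡_ _≡_ (H ∘ split)
  injective {i} {j} eq = begin
    i                              ≡⟨ combine-remQuot {2} (2 ^ m) i ⟨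
    Fin.combine (proj₁ (split i)) (proj₂ (split i))
      ≡⟨ cong (λ (x , y) → Fin.combine x y) (H-injective (split i) (split j) eq) ⟩
    Fin.combine (proj₁ (split j)) (proj₂ (split j)) ≡⟨ combine-remQuot {2} (2 ^ m) j ⟩
    j                              ∎

-- Induction on the number of variables. If both halves a₀, a₁ are nonzero, each vanishes to order
-- m, the first as (a₀ + a₁) - a₁, and the two counts of 2^m add up. If one half is zero, the other
-- equals a₀ + a₁ and so keeps the full order m + 1.
many-nonzero : ∀ m {k} (a : Subset k → ℤ) → Vanish m a → ∀ I → a I ≢ 0ℤ →
               ManySubsets m (λ I → a I ≢ 0ℤ)
many-nonzero zero a _ I aI≢0 = (λ _ → I) , (λ { {zero} {zero} _ → refl }) , λ _ → aI≢0
many-nonzero (suc m) {zero}  a v [] aI≢0 = contradiction v aI≢0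
many-nonzero (suc m) {suc k} a (v₊ , v₁) I₀ aI₀≢0
  with anySubset? (λ I → ¬? (a (outside ∷ I) ℤ.≟ 0ℤ)) | anySubset? (λ I → ¬? (a (inside ∷ I) ℤ.≟ 0ℤ))
... | yes (I , nz₀) | yes (J , nz₁) =
  many-both m (λ I → a I ≢ 0ℤ) (many-nonzero m _ v₀ I nz₀) (many-nonzero m _ v₁ J nz₁)
  where
  cancel : ∀ x y → x + y - y ≡ x
  cancel = solve-∀
  v₀ : Vanish m (λ I → a (outside ∷ I))
  v₀ = vanish-cong m (λ I → cancel (a (outside ∷ I)) (a (inside ∷ I)))
    (vanish-+ m (vanish-pred m v₊) (vanish-neg m v₁))
... | yes (I , nz₀) | no all-zero = many-∷ (suc m) outside (λ I → a I ≢ 0ℤ)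
  (many-nonzero (suc m) _ (vanish-cong (suc m) drop-zero v₊) I nz₀)
  where
  drop-zero : ∀ I → a (outside ∷ I) + a (inside ∷ I) ≡ a (outside ∷ I)
  drop-zero I = trans
    (cong (_+_ (a (outside ∷ I))) (decidable-stable (_ ℤ.≟ 0ℤ) λ nz → all-zero (I , nz)))
    (ℤ.+-identityʳ _)
... | no all-zero | yes (J , nz₁) = many-∷ (suc m) inside (λ I → a I ≢ 0ℤ)
  (many-nonzero (suc m) _ (vanish-cong (suc m) drop-zero v₊) J nz₁)
  where
  drop-zero : ∀ I → a (outside ∷ I) + a (inside ∷ I) ≡ a (inside ∷ I)
  drop-zero I = trans
    (cong (_+ a (inside ∷ I)) (decidable-stable (_ ℤ.≟ 0ℤ) λ nz → all-zero (I , nz)))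
    (ℤ.+-identityˡ _)
... | no all-zero₀ | no all-zero₁ = contradiction aI₀≢0 (zero-at I₀)
  where
  zero-at : ∀ I → ¬ (a I ≢ 0ℤ)
  zero-at (outside ∷ I) nz = all-zero₀ (I , nz)
  zero-at (inside  ∷ I) nz = all-zero₁ (I , nz)

-- Covers of ℤⁿ

sumIn : Subset k → (Fin k → ℤ) → ℤ
sumIn []            e = 0ℤ
sumIn (inside  ∷ I) e = e zero + sumIn I (e ∘ suc)
sumIn (outside ∷ I) e = sumIn I (e ∘ suc)

sumIn-minus : ∀ (I : Subset k) e f → sumIn I (λ s → e s - f s) ≡ sumIn I e - sumIn I f
sumIn-minus []            e f = refl
sumIn-minus (outside ∷ I) e f = sumIn-minus I (e ∘ suc) (f ∘ suc)
sumIn-minus (inside  ∷ I) e f =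
  trans (cong (_+_ (e zero - f zero)) (sumIn-minus I (e ∘ suc) (f ∘ suc)))
    (interchange (e zero) (f zero) (sumIn I (e ∘ suc)) (sumIn I (f ∘ suc)))
  where
  interchange : ∀ a b c d → (a - b) + (c - d) ≡ (a + c) - (b + d)
  interchange = solve-∀

dot : Vec ℤ n → (Fin n → ℤ) → ℤ
dot []      b = 0ℤ
dot (x ∷ v) b = x * b zero + dot v (b ∘ suc)

dot-0 : ∀ (v : Vec ℤ n) → dot v (λ _ → 0ℤ) ≡ 0ℤ
dot-0 []      = refl
dot-0 (x ∷ v) = cong₂ _+_ (ℤ.*-zeroʳ x) (dot-0 v)

dot-+ : ∀ (v : Vec ℤ n) b c → dot v (λ i → b i + c i) ≡ dot v b + dot v c
dot-+ []      b c = refl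
dot-+ (x ∷ v) b c = trans (cong (_+_ (x * (b zero + c zero))) (dot-+ v (b ∘ suc) (c ∘ suc)))
  (distrib x (b zero) (c zero) (dot v (b ∘ suc)) (dot v (c ∘ suc)))
  where
  distrib : ∀ x a b c d → x * (a + b) + (c + d) ≡ (x * a + c) + (x * b + d)
  distrib = solve-∀

dot-neg : ∀ (v : Vec ℤ n) b → dot v (λ i → - b i) ≡ - dot v b
dot-neg []      b = refl
dot-neg (x ∷ v) b = trans (cong (_+_ (x * - b zero)) (dot-neg v (b ∘ suc)))
  (distrib x (b zero) (dot v (b ∘ suc)))
  where
  distrib : ∀ x a b → x * - a + - b ≡ - (x * a + b)
  distrib = solve-∀

sumIn-dot : ∀ (I : Subset k) (v : Vec ℤ n) (b : Fin k → Fin n → ℤ) →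
            sumIn I (λ s → dot v (b s)) ≡ dot v (λ i → sumIn I (λ s → b s i))
sumIn-dot []            v b = sym (dot-0 v)
sumIn-dot (outside ∷ I) v b = sumIn-dot I v (b ∘ suc)
sumIn-dot (inside  ∷ I) v b = trans (cong (_+_ (dot v (b zero))) (sumIn-dot I v (b ∘ suc)))
  (sym (dot-+ v (b zero) (λ i → sumIn I (λ s → b (suc s) i))))

sgn : Subset k → ℤ
sgn []            = 1ℤ
sgn (inside  ∷ I) = - sgn I
sgn (outside ∷ I) = sgn I

sgn≢0 : ∀ (I : Subset k) → sgn I ≢ 0ℤ
sgn≢0 (inside  ∷ I) eq = sgn≢0 I (ℤ.neg-injective eq)
sgn≢0 (outside ∷ I) eq = sgn≢0 I eq

-- These are the coefficients of Π_s (1 - T_s τ^{e s}) applied to `h` and evaluated at `u`, τ being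
-- the unit shift. Whenever `e s` is a period of `h`, the factor acts as 1 - T_s and contributes one
-- order of vanishing.
vanish-periods : ∀ (h : ℤ → ℤ) (J : Subset k) e → (∀ s → s ∈ J → Period h (e s)) →
                 ∀ u → Vanish ∣ J ∣ (λ I → sgn I * h (u + sumIn I e))
vanish-periods h []            e pe u = tt
-- Both halves are instances of the claim, at `u` and, up to sign, at `u + e zero`; this is why `u`
-- is arbitrary.
vanish-periods h (outside ∷ J) e pe u = vanish-∷ ∣ J ∣
  (vanish-periods h J (e ∘ suc) (λ s → pe (suc s) ∘ there) u)
  (vanish-cong ∣ J ∣ (λ I → negate I)
    (vanish-neg ∣ J ∣ (vanish-periods h J (e ∘ suc) (λ s → pe (suc s) ∘ there) (u + e zero))))
  where
  negate : ∀ I → - (sgn I * h (u + e zero + sumIn I (e ∘ suc)))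
                 ≡ - sgn I * h (u + (e zero + sumIn I (e ∘ suc)))
  negate I = trans (ℤ.neg-distribˡ-* (sgn I) _)
    (cong (λ t → - sgn I * h t) (ℤ.+-assoc u (e zero) (sumIn I (e ∘ suc))))
-- A factor 1 - T₁: the two halves cancel by periodicity, so only the inside half has to vanish, to
-- one order less.
vanish-periods h (inside ∷ J) e pe u =
    vanish-cong (suc ∣ J ∣) cancel (vanish-0 (suc ∣ J ∣))
  , vanish-cong ∣ J ∣ negate
      (vanish-neg ∣ J ∣ (vanish-periods h J (e ∘ suc) (λ s → pe (suc s) ∘ there) u))
  where
  move : ∀ u a b → u + (a + b) ≡ u + b + a
  move = solve-∀
  periodic : ∀ I → h (u + (e zero + sumIn I (e ∘ suc))) ≡ h (u + sumIn I (e ∘ suc))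
  periodic I = trans (cong h (move u (e zero) (sumIn I (e ∘ suc)))) (pe zero here _)
  negate : ∀ I → - (sgn I * h (u + sumIn I (e ∘ suc)))
                 ≡ - sgn I * h (u + (e zero + sumIn I (e ∘ suc)))
  negate I = trans (ℤ.neg-distribˡ-* (sgn I) _) (cong (_*_ (- sgn I)) (sym (periodic I)))
  cancel : ∀ I → 0ℤ ≡ sgn I * h (u + sumIn I (e ∘ suc))
                      + - sgn I * h (u + (e zero + sumIn I (e ∘ suc)))
  cancel I = trans (sym (ℤ.+-inverseʳ (sgn I * h (u + sumIn I (e ∘ suc)))))
    (cong (_+_ (sgn I * h (u + sumIn I (e ∘ suc)))) (negate I))

-- Sums over representatives of (ℤ/N)ⁿ

module _ (N : ℕ) where

  boxSum : ∀ n → (Vec ℤ n → ℤ) → ℤ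
  boxSum zero    F = F []
  boxSum (suc n) F = ∑ N (λ j → boxSum n (λ v → F (+ j ∷ v)))

  boxSum-cong : ∀ n {F G : Vec ℤ n → ℤ} → (∀ v → F v ≡ G v) → boxSum n F ≡ boxSum n G
  boxSum-cong zero    F≗G = F≗G []
  boxSum-cong (suc n) F≗G = ∑-cong N (λ j → boxSum-cong n (λ v → F≗G (+ j ∷ v)))

  boxSum-* : ∀ n c (F : Vec ℤ n → ℤ) → boxSum n (λ v → c * F v) ≡ c * boxSum n F
  boxSum-* zero    c F = refl
  boxSum-* (suc n) c F = trans (∑-cong N (λ j → boxSum-* n c (λ v → F (+ j ∷ v)))) (∑-* N _)
    where
    ∑-* : ∀ M f → ∑ M (λ j → c * f j) ≡ c * ∑ M f
    ∑-* zero    f = sym (ℤ.*-zeroʳ c)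
    ∑-* (suc M) f = trans (cong (_+_ (c * f M)) (∑-* M f)) (sym (ℤ.*-distribˡ-+ c (f M) (∑ M f)))

  boxSum-∑ : ∀ n M (F : ℕ → Vec ℤ n → ℤ) →
             ∑ M (λ j → boxSum n (F j)) ≡ boxSum n (λ v → ∑ M (λ j → F j v))
  boxSum-∑ zero    M F = refl
  boxSum-∑ (suc n) M F = trans (∑-swap M N (λ j i → boxSum n (λ v → F j (+ i ∷ v))))
    (∑-cong N (λ i → boxSum-∑ n M (λ j v → F j (+ i ∷ v))))

  boxSum-0 : ∀ n → boxSum n (λ _ → 0ℤ) ≡ 0ℤ
  boxSum-0 zero    = refl
  boxSum-0 (suc n) = trans (∑-cong N (λ _ → boxSum-0 n)) (∑-zero N)

  boxSum-const≢0 : .{{_ : NonZero N}} → ∀ n {c} → c ≢ 0ℤ → boxSum n (λ _ → c) ≢ 0ℤ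
  boxSum-const≢0 zero    c≢0 = c≢0
  boxSum-const≢0 (suc n) {c} c≢0 eq
    with ℤ.i*j≡0⇒i≡0∨j≡0 (+ N) (trans (sym (∑-const N (boxSum n (λ _ → c)))) eq)
    where
    ∑-const : ∀ M c → ∑ M (λ _ → c) ≡ + M * c
    ∑-const zero    c = refl
    ∑-const (suc M) c = trans (cong (_+_ c) (∑-const M c)) (sym (ℤ.suc-* (+ M) c))
  ... | inj₁ N≡0 = ℕ.≢-nonZero⁻¹ N (ℤ.+-injective N≡0)
  ... | inj₂ s≡0 = boxSum-const≢0 n c≢0 s≡0

  -- A single coordinate with vanishing orbit sums suffices: summing over it innermost already gives
  -- 0, while the other coordinates only move the base point `u`.
  boxSum-orthogonal : ∀ {n} (h : ℤ → ℤ) (b : Fin n → ℤ) i → (∀ t → orbitSum N (b i) h t ≡ 0ℤ) →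
                      ∀ u → boxSum n (λ v → h (u + dot v b)) ≡ 0ℤ
  boxSum-orthogonal {suc n} h b zero orth u = begin
    ∑ N (λ j → boxSum n (λ v → h (u + (+ j * b zero + dot v (b ∘ suc)))))
      ≡⟨ boxSum-∑ n N (λ j v → h (u + (+ j * b zero + dot v (b ∘ suc)))) ⟩
    boxSum n (λ v → ∑ N (λ j → h (u + (+ j * b zero + dot v (b ∘ suc)))))
      ≡⟨ boxSum-cong n (λ v → trans
           (∑-cong N (λ j → cong h (move u (+ j * b zero) (dot v (b ∘ suc)))))
           (orth (u + dot v (b ∘ suc)))) ⟩
    boxSum n (λ _ → 0ℤ)
      ≡⟨ boxSum-0 n ⟩
    0ℤ ∎
    where
    move : ∀ u a b → u + (a + b) ≡ u + b + a
    move = solve-∀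
  boxSum-orthogonal {suc n} h b (suc i) orth u = trans
    (∑-cong N (λ j → trans
      (boxSum-cong n (λ v → cong h (sym (ℤ.+-assoc u (+ j * b zero) (dot v (b ∘ suc))))))
      (boxSum-orthogonal h (b ∘ suc) i orth (u + + j * b zero))))
    (∑-zero N)

  vanish-boxSum : ∀ m n {k} (F : Vec ℤ n → Subset k → ℤ) → (∀ v → Vanish m (F v)) →
                  Vanish m (λ I → boxSum n (λ v → F v I))
  vanish-boxSum m zero    F vF = vF []
  vanish-boxSum m (suc n) F vF = vanish-∑ N λ j →
    vanish-boxSum m n (λ v → F (+ j ∷ v)) (λ v → vF (+ j ∷ v))
    where
    vanish-∑ : ∀ M {k} {f : ℕ → Subset k → ℤ} → (∀ j → Vanish m (f j)) →
               Vanish m (λ I → ∑ M (λ j → f j I))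
    vanish-∑ zero    vf = vanish-0 m
    vanish-∑ (suc M) vf = vanish-+ m (vf M) (vanish-∑ M vf)

-- From an m-fold cover of ℤⁿ by congruence conditions to 2^m congruent subset sums

module _ (N : ℕ) .{{_ : NonZero N}} (b : Fin k → Fin n → ℤ) (A : Fin k → ℤ)
         (cover : ∀ v → Σ (Subset k) λ J → m ≤ ∣ J ∣ × (∀ s → s ∈ J → + N ∣ dot v (b s) - A s))
         where

  open PrimitiveKernel (primitiveKernel N)

  private
    total : Subset k → Fin n → ℤ
    total I i = sumIn I (λ s → b s i)

    -- The exponent of ζ_I⁻¹ χ_x(g_I - g_{I₀}), where g_{I₀} stands in for μ, normalised by the
    -- constant ζ_{I₀} so that it is 0 at I = I₀.
    phase : Subset k → Subset k → Vec ℤ n → ℤ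
    phase I₀ I v = sumIn I₀ A - sumIn I A + dot v (λ i → total I i - total I₀ i)

    coefficient : Subset k → Subset k → ℤ
    coefficient I₀ I = sgn I * boxSum N n (λ v → θ (phase I₀ I v))

    -- Separates a base point independent of I from a sum over s ∈ I whose summands are divisible by
    -- N wherever v is covered: the shape that `vanish-periods` requires.
    phase-factors : ∀ I₀ I v → sumIn I₀ A - dot v (total I₀) + sumIn I (λ s → dot v (b s) - A s)
                               ≡ phase I₀ I v
    phase-factors I₀ I v = begin
      a₀ - D₀ + sumIn I (λ s → dot v (b s) - A s)     ≡⟨ cong (_+_ (a₀ - D₀)) (sumIn-minus I (λ s → dot v (b s)) A) ⟩
      a₀ - D₀ + (sumIn I (λ s → dot v (b s)) - a)     ≡⟨ cong (λ z → a₀ - D₀ + (z - a)) (sumIn-dot I v b) ⟩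
      a₀ - D₀ + (dot v (total I) - a)                 ≡⟨ rearrange a₀ a D₀ (dot v (total I)) ⟩
      a₀ - a + (dot v (total I) - D₀)                 ≡⟨ cong (λ z → a₀ - a + (dot v (total I) + z)) (dot-neg v (total I₀)) ⟨
      a₀ - a + (dot v (total I) + dot v (λ i → - total I₀ i))
        ≡⟨ cong (_+_ (a₀ - a)) (dot-+ v (total I) (λ i → - total I₀ i)) ⟨
      phase I₀ I v                                    ∎
      where
      a₀ = sumIn I₀ A
      a  = sumIn I A
      D₀ = dot v (total I₀)
      rearrange : ∀ w x y z → w - y + (z - x) ≡ w - x + (z - y)
      rearrange = solve-∀

    vanish-coefficient : ∀ I₀ → Vanish m (coefficient I₀)
    vanish-coefficient I₀ = vanish-cong m (λ I → boxSum-* N n (sgn I) (λ v → θ (phase I₀ I v)))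
      (vanish-boxSum N m n (λ v I → sgn I * θ (phase I₀ I v)) vanish-at)
      where
      vanish-at : ∀ v → Vanish m (λ I → sgn I * θ (phase I₀ I v))
      vanish-at v with cover v
      ... | J , m≤∣J∣ , N∣ = vanish-cong m (λ I → cong (λ t → sgn I * θ t) (phase-factors I₀ I v))
        (vanish-≤ m≤∣J∣ (vanish-periods θ J (λ s → dot v (b s) - A s)
          (λ s s∈J → period-∣ {θ} (N∣ s s∈J) periodic) (sumIn I₀ A - dot v (total I₀))))

    -- At I = I₀ the phase is 0 for every v, so the box sum is N^n θ(0) = N^n.
    coefficient≢0 : ∀ I₀ → coefficient I₀ I₀ ≢ 0ℤ
    coefficient≢0 I₀ eq with ℤ.i*j≡0⇒i≡0∨j≡0 (sgn I₀) eq
    ... | inj₁ sgn≡0 = sgn≢0 I₀ sgn≡0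
    ... | inj₂ sum≡0 = boxSum-const≢0 N n {1ℤ} (λ ())
      (trans (sym (boxSum-cong N n (λ v → trans (cong θ (phase≡0 v)) θ0≡1))) sum≡0)
      where
      phase≡0 : ∀ v → phase I₀ I₀ v ≡ 0ℤ
      phase≡0 v = trans (sym (phase-factors I₀ I₀ v))
        (trans (cong (_+_ (sumIn I₀ A - dot v (total I₀))) (trans (sumIn-minus I₀ (λ s → dot v (b s)) A)
                                    (cong (_- sumIn I₀ A) (sumIn-dot I₀ v b))))
          (cancel (sumIn I₀ A) (dot v (total I₀))))
        where
        cancel : ∀ x y → x - y + (y - x) ≡ 0ℤ
        cancel = solve-∀

    -- If N failed to divide the i-th difference, summing θ over the i-th coordinate would
    -- annihilate the coefficient.
    support : ∀ I₀ I → coefficient I₀ I ≢ 0ℤ → ∀ i → + N ∣ total I i - total I₀ i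
    support I₀ I c≢0 i = decidable-stable (+ N ∣? _) λ N∤ → c≢0
      (trans (cong (_*_ (sgn I)) (boxSum-orthogonal N θ (λ i → total I i - total I₀ i) i
               (orthogonal _ N∤) (sumIn I₀ A - sumIn I A)))
        (ℤ.*-zeroʳ (sgn I)))

  many-congruent : ∀ I₀ → ManySubsets m λ I →
                   ∀ i → + N ∣ sumIn I (λ s → b s i) - sumIn I₀ (λ s → b s i)
  many-congruent I₀ = many-map m (support I₀)
    (many-nonzero m (coefficient I₀) (vanish-coefficient I₀) I₀ (coefficient≢0 I₀))

-- Integers among the rationals

toℚᵘ-ℤ→ℚ : ∀ z → ℚ.toℚᵘ (ℤ→ℚ z) ℚᵘ.≃ mkℚᵘ z 0
toℚᵘ-ℤ→ℚ z = ℚ.toℚᵘ-fromℚᵘ (mkℚᵘ z 0)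

ℤ→ℚ-+ : ∀ y z → ℤ→ℚ (y + z) ≡ ℤ→ℚ y ℚ.+ ℤ→ℚ z
ℤ→ℚ-+ y z = ℚ.toℚᵘ-injective (ℚᵘ.≃-trans (toℚᵘ-ℤ→ℚ (y + z)) (ℚᵘ.≃-trans (*≡* (expand y z))
  (ℚᵘ.≃-sym (ℚᵘ.≃-trans (ℚ.toℚᵘ-homo-+ (ℤ→ℚ y) (ℤ→ℚ z))
    (ℚᵘ.+-cong (toℚᵘ-ℤ→ℚ y) (toℚᵘ-ℤ→ℚ z))))))
  where
  expand : ∀ y z → (y + z) * 1ℤ ≡ (y * 1ℤ + z * 1ℤ) * 1ℤ
  expand = solve-∀

ℤ→ℚ-* : ∀ y z → ℤ→ℚ (y * z) ≡ ℤ→ℚ y ℚ.* ℤ→ℚ z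
ℤ→ℚ-* y z = ℚ.toℚᵘ-injective (ℚᵘ.≃-trans (toℚᵘ-ℤ→ℚ (y * z))
  (ℚᵘ.≃-sym (ℚᵘ.≃-trans (ℚ.toℚᵘ-homo-* (ℤ→ℚ y) (ℤ→ℚ z))
    (ℚᵘ.*-cong (toℚᵘ-ℤ→ℚ y) (toℚᵘ-ℤ→ℚ z)))))

ℤ→ℚ-neg : ∀ z → ℤ→ℚ (- z) ≡ ℚ.- ℤ→ℚ z
ℤ→ℚ-neg z = ℚ.toℚᵘ-injective (ℚᵘ.≃-trans (toℚᵘ-ℤ→ℚ (- z))
  (ℚᵘ.≃-sym (ℚᵘ.≃-trans (ℚ.toℚᵘ-homo‿- (ℤ→ℚ z)) (ℚᵘ.-‿cong (toℚᵘ-ℤ→ℚ z)))))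

ℤ→ℚ-minus : ∀ y z → ℤ→ℚ (y - z) ≡ ℤ→ℚ y ℚ.- ℤ→ℚ z
ℤ→ℚ-minus y z = trans (ℤ→ℚ-+ y (- z)) (cong (ℤ→ℚ y ℚ.+_) (ℤ→ℚ-neg z))

ℤ→ℚ-injective : ∀ {y z} → ℤ→ℚ y ≡ ℤ→ℚ z → y ≡ z
ℤ→ℚ-injective {y} {z} eq
  with ℚᵘ.≃-trans (ℚᵘ.≃-sym (toℚᵘ-ℤ→ℚ y)) (ℚᵘ.≃-trans (ℚ.toℚᵘ-cong eq) (toℚᵘ-ℤ→ℚ z))
... | *≡* y1≡z1 = ℤ.*-cancelʳ-≡ y z 1ℤ y1≡z1

IsInteger : ℚ → Set
IsInteger r = Σ ℤ λ z → r ≡ ℤ→ℚ z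

isInteger-+ : ∀ {r s} → IsInteger r → IsInteger s → IsInteger (r ℚ.+ s)
isInteger-+ (y , refl) (z , refl) = y + z , sym (ℤ→ℚ-+ y z)

isInteger-* : ∀ {r s} → IsInteger r → IsInteger s → IsInteger (r ℚ.* s)
isInteger-* (y , refl) (z , refl) = y * z , sym (ℤ→ℚ-* y z)

isInteger-neg : ∀ {r} → IsInteger r → IsInteger (ℚ.- r)
isInteger-neg (z , refl) = - z , sym (ℤ→ℚ-neg z)

denominator-clears : ∀ r → IsInteger (ℤ→ℚ (ℚ.↧ r) ℚ.* r)
denominator-clears r@record{} = ℚ.↥ r , ℚ.toℚᵘ-injective
  (ℚᵘ.≃-trans (ℚ.toℚᵘ-homo-* (ℤ→ℚ (ℚ.↧ r)) r)
  (ℚᵘ.≃-trans (ℚᵘ.*-congʳ {ℚ.toℚᵘ r} (toℚᵘ-ℤ→ℚ (ℚ.↧ r)))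
  (ℚᵘ.≃-trans (*≡* (clear (ℚ.↧ r) (ℚ.↥ r))) (ℚᵘ.≃-sym (toℚᵘ-ℤ→ℚ (ℚ.↥ r))))))
  where
  clear : ∀ d n → d * n * 1ℤ ≡ n * (1ℤ * d)
  clear = solve-∀

-- Common denominators

ClearedBy : ℚ → ℕ → Set
ClearedBy r N = IsInteger (ℤ→ℚ (+ N) ℚ.* r)

clearedBy-*ˡ : ∀ {r} M N → ClearedBy r N → ClearedBy r (M ℕ.* N)
clearedBy-*ˡ {r} M N c = subst IsInteger
  (trans (sym (ℚ.*-assoc (ℤ→ℚ (+ M)) (ℤ→ℚ (+ N)) r))
    (cong (ℚ._* r) (trans (sym (ℤ→ℚ-* (+ M) (+ N))) (cong ℤ→ℚ (sym (ℤ.pos-* M N))))))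
  (isInteger-* (+ M , refl) c)

-- The product of the individual numbers works, as each property passes to multiples. Stated for
-- general P because it is applied twice, over s and over the coordinates.
common-multiple : ∀ {n} (P : Fin n → ℕ → Set) → (∀ i M N → P i N → P i (M ℕ.* N)) →
                  (∀ i → ∃[ N ] NonZero N × P i N) → ∃[ N ] NonZero N × (∀ i → P i N)
common-multiple {zero}  P P-* pt = 1 , _ , λ ()
common-multiple {suc n} P P-* pt with pt zero | common-multiple (P ∘ suc) (P-* ∘ suc) (pt ∘ suc)
... | M , M≢0 , pM | N , N≢0 , pN = M ℕ.* N , ℕ.m*n≢0 M N {{M≢0}} {{N≢0}} , λ where
  zero    → subst (P zero) (ℕ.*-comm N M) (P-* zero N M pM)
  (suc i) → P-* (suc i) M N (pN i)

common-denominator : (q : Fin k → Fin n → ℚ) → ∃[ N ] NonZero N × (∀ s i → ClearedBy (q s i) N)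
common-denominator q = common-multiple (λ s N → ∀ i → ClearedBy (q s i) N)
  (λ s M N c i → clearedBy-*ˡ M N (c i))
  (λ s → common-multiple (λ i → ClearedBy (q s i)) (λ i → clearedBy-*ˡ)
    (λ i → ℚ.↧ₙ (q s i) , _ , denominator-clears (q s i)))

ℤ→ℚ-cancelˡ : ∀ N .{{_ : NonZero N}} {r s} → ℤ→ℚ (+ N) ℚ.* r ≡ ℤ→ℚ (+ N) ℚ.* s → r ≡ s
ℤ→ℚ-cancelˡ N {r} {s} eq = begin
  r                       ≡⟨ undo r ⟨
  1/ν ℚ.* (ν ℚ.* r)       ≡⟨ cong (1/ν ℚ.*_) eq ⟩
  1/ν ℚ.* (ν ℚ.* s)       ≡⟨ undo s ⟩
  s                       ∎
  where
  ν = ℤ→ℚ (+ N)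
  instance
    ν≢0 : ℚ.NonZero ν
    ν≢0 = ℚ.≢-nonZero λ ν≡0 → ℕ.≢-nonZero⁻¹ N (ℤ.+-injective (ℤ→ℚ-injective {+ N} {0ℤ} ν≡0))
  1/ν = ℚ.1/ ν
  undo : ∀ r → 1/ν ℚ.* (ν ℚ.* r) ≡ r
  undo r = trans (sym (ℚ.*-assoc 1/ν ν r))
    (trans (cong (ℚ._* r) (ℚ.*-inverseˡ ν)) (ℚ.*-identityˡ r))

-- Arithmetic of ℚ[γ]

module _ {d : ℕ} (c : Fin (suc d) → ℤ) where

  private
    K = Elem d
    variable
      x y z w : K

  infix 4 _≈_
  _≈_ : K → K → Set
  _≈_ = _≈K_

  ≈-sym : x ≈ y → y ≈ x
  ≈-sym p i = sym (p i)

  ≈-trans : x ≈ y → y ≈ z → x ≈ z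
  ≈-trans p q i = trans (p i) (q i)

  addK-cong : x ≈ y → z ≈ w → addK x z ≈ addK y w
  addK-cong p q i = cong₂ ℚ._+_ (p i) (q i)

  γ : K → K
  γ = mulγ c

  γ-cong : x ≈ y → γ x ≈ γ y
  γ-cong p zero    = cong (λ t → ℚ.- (ℤ→ℚ (c zero) ℚ.* t)) (p (fromℕ d))
  γ-cong p (suc j) = cong₂ (λ s t → s ℚ.- ℤ→ℚ (c (suc j)) ℚ.* t) (p (inject₁ j)) (p (fromℕ d))

  γ-+ : ∀ x y → γ (addK x y) ≈ addK (γ x) (γ y)
  γ-+ x y zero = solve 3
    (λ c s t → :- (c :* (s :+ t)) := (:- (c :* s)) :+ (:- (c :* t))) refl
    (ℤ→ℚ (c zero)) (x (fromℕ d)) (y (fromℕ d))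
  γ-+ x y (suc j) = solve 5
    (λ c s t u v → (u :+ v) :- (c :* (s :+ t)) := (u :- (c :* s)) :+ (v :- (c :* t))) refl
    (ℤ→ℚ (c (suc j))) (x (fromℕ d)) (y (fromℕ d)) (x (inject₁ j)) (y (inject₁ j))

  γ-scale : ∀ q x → γ (scaleK q x) ≈ scaleK q (γ x)
  γ-scale q x zero = solve 3
    (λ c q s → :- (c :* (q :* s)) := q :* (:- (c :* s))) refl
    (ℤ→ℚ (c zero)) q (x (fromℕ d))
  γ-scale q x (suc j) = solve 4
    (λ c q s u → (q :* u) :- (c :* (q :* s)) := q :* (u :- (c :* s))) refl
    (ℤ→ℚ (c (suc j))) q (x (fromℕ d)) (x (inject₁ j))

  γ-0 : γ zeroK ≈ zeroK
  γ-0 zero    = cong ℚ.-_ (ℚ.*-zeroʳ (ℤ→ℚ (c zero)))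
  γ-0 (suc j) = cong (λ t → 0ℚ ℚ.- t) (ℚ.*-zeroʳ (ℤ→ℚ (c (suc j))))

  -- The operator Σ_{i<n} b_i γ^i. The length n is free, unlike in `mulK`, so that induction on it
  -- is possible.
  horner : ∀ n → (Fin n → ℚ) → K → K
  horner zero    b x = zeroK
  horner (suc n) b x = addK (γ (horner n (b ∘ suc) x)) (scaleK (b zero) x)

  foldr-horner : ∀ {n} (b : Fin (suc d) → ℚ) x (g : Fin n → Fin (suc d)) →
    foldr (λ i r → addK (γ r) (scaleK (b i) x)) zeroK (tabulate g) ≡ horner n (b ∘ g) x
  foldr-horner {zero}  b x g = refl
  foldr-horner {suc n} b x g =
    cong (λ r → addK (γ r) (scaleK (b (g zero)) x)) (foldr-horner b x (g ∘ suc))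

  horner-cong : ∀ n b → x ≈ y → horner n b x ≈ horner n b y
  horner-cong zero    b p i = refl
  horner-cong (suc n) b p =
    addK-cong (γ-cong (horner-cong n (b ∘ suc) p)) (λ i → cong (b zero ℚ.*_) (p i))

  horner-congᵇ : ∀ n {b b′} x → (∀ i → b i ≡ b′ i) → horner n b x ≈ horner n b′ x
  horner-congᵇ zero    x p i = refl
  horner-congᵇ (suc n) x p =
    addK-cong (γ-cong (horner-congᵇ n x (p ∘ suc))) (λ i → cong (ℚ._* x i) (p zero))

  horner-0 : ∀ n b → horner n b zeroK ≈ zeroK
  horner-0 zero    b i = refl
  horner-0 (suc n) b i = cong₂ ℚ._+_
    (≈-trans {x = γ (horner n (b ∘ suc) zeroK)} (γ-cong (horner-0 n (b ∘ suc))) γ-0 i)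
    (ℚ.*-zeroʳ (b zero))

  private
    interchange : ∀ s t u v → (s ℚ.+ t) ℚ.+ (u ℚ.+ v) ≡ (s ℚ.+ u) ℚ.+ (t ℚ.+ v)
    interchange = solve 4
      (λ s t u v → (s :+ t) :+ (u :+ v) := (s :+ u) :+ (t :+ v)) refl

  horner-+ : ∀ n b x y → horner n b (addK x y) ≈ addK (horner n b x) (horner n b y)
  horner-+ zero    b x y i = refl
  horner-+ (suc n) b x y i = begin
    γ (horner n b′ (addK x y)) i ℚ.+ b zero ℚ.* (x i ℚ.+ y i)
      ≡⟨ cong₂ ℚ._+_ (≈-trans {x = γ (horner n b′ (addK x y))}
          (γ-cong (horner-+ n b′ x y)) (γ-+ (horner n b′ x) (horner n b′ y)) i)
                     (ℚ.*-distribˡ-+ (b zero) (x i) (y i)) ⟩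
    (γ (horner n b′ x) i ℚ.+ γ (horner n b′ y) i) ℚ.+ (b zero ℚ.* x i ℚ.+ b zero ℚ.* y i)
      ≡⟨ interchange (γ (horner n b′ x) i) (γ (horner n b′ y) i) (b zero ℚ.* x i) (b zero ℚ.* y i) ⟩
    addK (horner (suc n) b x) (horner (suc n) b y) i ∎
    where b′ = b ∘ suc

  horner-+ᵇ : ∀ n b b′ x → horner n (λ i → b i ℚ.+ b′ i) x ≈ addK (horner n b x) (horner n b′ x)
  horner-+ᵇ zero    b b′ x i = refl
  horner-+ᵇ (suc n) b b′ x i = trans
    (cong₂ ℚ._+_ (≈-trans {x = γ (horner n (λ i → b (suc i) ℚ.+ b′ (suc i)) x)}
                          (γ-cong (horner-+ᵇ n (b ∘ suc) (b′ ∘ suc) x))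
                          (γ-+ (horner n (b ∘ suc) x) (horner n (b′ ∘ suc) x)) i)
                 (ℚ.*-distribʳ-+ (x i) (b zero) (b′ zero)))
    (interchange (γ (horner n (b ∘ suc) x) i) (γ (horner n (b′ ∘ suc) x) i)
                 (b zero ℚ.* x i) (b′ zero ℚ.* x i))

  horner-scale : ∀ n b q x → horner n b (scaleK q x) ≈ scaleK q (horner n b x)
  horner-scale zero    b q x i = sym (ℚ.*-zeroʳ q)
  horner-scale (suc n) b q x i = trans
    (cong (ℚ._+ b zero ℚ.* (q ℚ.* x i))
      (≈-trans {x = γ (horner n (b ∘ suc) (scaleK q x))}
        (γ-cong (horner-scale n (b ∘ suc) q x)) (γ-scale q (horner n (b ∘ suc) x)) i))
    (solve 4 (λ q g b x → (q :* g) :+ (b :* (q :* x)) := q :* (g :+ (b :* x))) refl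
      q (γ (horner n (b ∘ suc) x) i) (b zero) (x i))

  horner-γ : ∀ n b x → horner n b (γ x) ≈ γ (horner n b x)
  horner-γ zero    b x = ≈-sym γ-0
  horner-γ (suc n) b x i = begin
    γ (horner n (b ∘ suc) (γ x)) i ℚ.+ b zero ℚ.* γ x i
      ≡⟨ cong₂ ℚ._+_ (γ-cong (horner-γ n (b ∘ suc) x) i) (sym (γ-scale (b zero) x i)) ⟩
    γ (γ (horner n (b ∘ suc) x)) i ℚ.+ γ (scaleK (b zero) x) i
      ≡⟨ γ-+ (γ (horner n (b ∘ suc) x)) (scaleK (b zero) x) i ⟨
    γ (horner (suc n) b x) i ∎

  -- Two polynomials in the same linear operator commute; induction on the first reduces this to
  -- commuting with γ and with scalars.
  horner-comm : ∀ m n b b′ x → horner m b (horner n b′ x) ≈ horner n b′ (horner m b x)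
  horner-comm zero    n b b′ x = ≈-sym (horner-0 n b′)
  horner-comm (suc m) n b b′ x i = begin
    γ (horner m (b ∘ suc) (horner n b′ x)) i ℚ.+ b zero ℚ.* horner n b′ x i
      ≡⟨ cong₂ ℚ._+_ (γ-cong (horner-comm m n (b ∘ suc) b′ x) i)
                     (sym (horner-scale n b′ (b zero) x i)) ⟩
    γ (horner n b′ (horner m (b ∘ suc) x)) i ℚ.+ horner n b′ (scaleK (b zero) x) i
      ≡⟨ cong (ℚ._+ horner n b′ (scaleK (b zero) x) i) (horner-γ n b′ (horner m (b ∘ suc) x) i) ⟨
    horner n b′ (γ (horner m (b ∘ suc) x)) i ℚ.+ horner n b′ (scaleK (b zero) x) i
      ≡⟨ horner-+ n b′ (γ (horner m (b ∘ suc) x)) (scaleK (b zero) x) i ⟨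
    horner n b′ (horner (suc m) b x) i ∎

  pad : ∀ n → (Fin n → ℚ) → ∀ {l} → Fin l → ℚ
  pad zero    b i       = 0ℚ
  pad (suc n) b zero    = b zero
  pad (suc n) b (suc i) = pad n (b ∘ suc) i

  pad-fromℕ : ∀ {n l} b → n ≤ l → pad n b (fromℕ l) ≡ 0ℚ
  pad-fromℕ {zero}  b _         = refl
  pad-fromℕ {suc n} b (s≤s n≤l) = pad-fromℕ (b ∘ suc) n≤l

  pad-inject₁ : ∀ n b {l} (j : Fin l) → pad n b (inject₁ j) ≡ pad n b j
  pad-inject₁ zero    b j       = refl
  pad-inject₁ (suc n) b zero    = refl
  pad-inject₁ (suc n) b (suc j) = pad-inject₁ n (b ∘ suc) j

  pad-full : ∀ n b i → pad n b {n} i ≡ b i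
  pad-full (suc n) b zero    = refl
  pad-full (suc n) b (suc i) = pad-full n (b ∘ suc) i

  -- Below degree `suc d` no reduction by the defining polynomial occurs: the top coordinate is 0
  -- before each multiplication by γ, which is therefore a plain shift of coordinates.
  horner-pad : ∀ n b → n ≤ suc d → horner n b oneK ≈ pad n b
  horner-pad zero    b n≤d i = refl
  horner-pad (suc n) b (s≤s n≤d) i = trans
    (cong (ℚ._+ b zero ℚ.* oneK i) (γ-cong (horner-pad n (b ∘ suc) (ℕ.m≤n⇒m≤1+n n≤d)) i))
    (shift i)
    where
    top≡0 : pad n (b ∘ suc) (fromℕ d) ≡ 0ℚ
    top≡0 = pad-fromℕ (b ∘ suc) n≤d
    shift : ∀ i → γ (pad n (b ∘ suc)) i ℚ.+ b zero ℚ.* oneK i ≡ pad (suc n) b i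
    shift zero    = trans (cong (λ t → ℚ.- (ℤ→ℚ (c zero) ℚ.* t) ℚ.+ b zero ℚ.* 1ℚ) top≡0)
      (solve 2 (λ c b → (:- (c :* con 0ℚ)) :+ (b :* con 1ℚ) := b) refl (ℤ→ℚ (c zero)) (b zero))
    shift (suc j) = trans
      (cong₂ (λ s t → s ℚ.- ℤ→ℚ (c (suc j)) ℚ.* t ℚ.+ b zero ℚ.* 0ℚ)
        (pad-inject₁ n (b ∘ suc) j) top≡0)
      (solve 3 (λ c b s → (s :- (c :* con 0ℚ)) :+ (b :* con 0ℚ) := s) refl
        (ℤ→ℚ (c (suc j))) (b zero) (pad n (b ∘ suc) j))

  -- mulBy b is a polynomial in γ; such operators commute with each other and are determined by
  -- their value at 1, whence commutativity and associativity of mulK.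
  mulBy : K → K → K
  mulBy = horner (suc d)

  mulK≈mulBy : ∀ x b → mulK c x b ≈ mulBy b x
  mulK≈mulBy x b i = cong (λ f → f i) (foldr-horner b x (λ i → i))

  mulBy-one : ∀ b → mulBy b oneK ≈ b
  mulBy-one b = ≈-trans {x = mulBy b oneK} (horner-pad (suc d) b ℕ.≤-refl) (pad-full (suc d) b)

  mulBy-comm : ∀ b x → mulBy b x ≈ mulBy x b
  mulBy-comm b x i = begin
    mulBy b x i          ≡⟨ horner-cong (suc d) b (mulBy-one x) i ⟨
    mulBy b (mulBy x oneK) i ≡⟨ horner-comm (suc d) (suc d) b x oneK i ⟩
    mulBy x (mulBy b oneK) i ≡⟨ horner-cong (suc d) x (mulBy-one b) i ⟩
    mulBy x b i          ∎

  mulBy-assoc : ∀ b x y → mulBy (mulBy b x) y ≈ mulBy b (mulBy x y)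
  mulBy-assoc b x y i = begin
    mulBy (mulBy b x) y i    ≡⟨ mulBy-comm (mulBy b x) y i ⟩
    mulBy y (mulBy b x) i    ≡⟨ horner-comm (suc d) (suc d) y b x i ⟩
    mulBy b (mulBy y x) i    ≡⟨ horner-cong (suc d) b (mulBy-comm y x) i ⟩
    mulBy b (mulBy x y) i    ∎

  γ-integer : InZγ x → InZγ (γ x)
  γ-integer xℤ zero    = isInteger-neg (isInteger-* (c zero , refl) (xℤ (fromℕ d)))
  γ-integer xℤ (suc j) =
    isInteger-+ (xℤ (inject₁ j)) (isInteger-neg (isInteger-* (c (suc j) , refl) (xℤ (fromℕ d))))

  horner-integer : ∀ n {b} → (∀ i → IsInteger (b i)) → InZγ x → InZγ (horner n b x)
  horner-integer zero    bℤ xℤ i = 0ℤ , refl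
  horner-integer (suc n) bℤ xℤ i =
    isInteger-+ (γ-integer (horner-integer n (bℤ ∘ suc) xℤ) i) (isInteger-* (bℤ zero) (xℤ i))

  -- φ i (γ^j) is 0 for i + j < d and 1 for i + j = d, so (x, y) ↦ top (x y) is a perfect pairing
  -- on ℤ[γ].
  top : K → ℚ
  top x = x (fromℕ d)

  γ^ : ℕ → K → K
  γ^ zero    x = x
  γ^ (suc i) x = γ^ i (γ x)

  φ : ℕ → K → ℚ
  φ i x = top (γ^ i x)

  γ^-cong : ∀ i → x ≈ y → γ^ i x ≈ γ^ i y
  γ^-cong zero    p = p
  γ^-cong (suc i) p = γ^-cong i (γ-cong p)

  γ^-integer : ∀ i → InZγ x → InZγ (γ^ i x)
  γ^-integer zero    xℤ = xℤ
  γ^-integer (suc i) xℤ = γ^-integer i (γ-integer xℤ)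

  φ-0 : ∀ i → φ i zeroK ≡ 0ℚ
  φ-0 zero    = refl
  φ-0 (suc i) = trans (γ^-cong i γ-0 (fromℕ d)) (φ-0 i)

  φ-+ : ∀ i x y → φ i (addK x y) ≡ φ i x ℚ.+ φ i y
  φ-+ zero    x y = refl
  φ-+ (suc i) x y = trans (γ^-cong i (γ-+ x y) (fromℕ d)) (φ-+ i (γ x) (γ y))

  φ-scale : ∀ i q x → φ i (scaleK q x) ≡ q ℚ.* φ i x
  φ-scale zero    q x = refl
  φ-scale (suc i) q x = trans (γ^-cong i (γ-scale q x) (fromℕ d)) (φ-scale i q (γ x))

  -- Descent from the top coordinate, which is φ 0. Coordinate j of x is coordinate j + 1 of γ x
  -- plus an integer multiple of top x, and φ i (γ x) = φ (i + 1) x, so each step down costs one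
  -- functional. The bound d ≤ j + t says that enough of them are left.
  φ-integer⇒integer : ∀ t x → (∀ i → i ≤ t → IsInteger (φ i x)) →
                      ∀ j → d ≤ toℕ j ℕ.+ t → IsInteger (x j)
  φ-integer⇒integer t x φℤ j d≤ with view j
  φ-integer⇒integer t x φℤ _ d≤ | ‵fromℕ = φℤ 0 z≤n
  φ-integer⇒integer zero x φℤ _ d≤ | ‵inject₁ j = contradiction
    (subst (d ≤_) (trans (ℕ.+-identityʳ _) (toℕ-inject₁ j)) d≤) (ℕ.<⇒≱ (toℕ<n j))
  φ-integer⇒integer (suc t) x φℤ _ d≤ | ‵inject₁ j = subst IsInteger
    (solve 2 (λ a b → (a :- b) :+ b := a) refl
      (x (inject₁ j)) (ℤ→ℚ (c (suc j)) ℚ.* top x))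
    (isInteger-+
      (φ-integer⇒integer t (γ x) (λ i i≤t → φℤ (suc i) (s≤s i≤t)) (suc j)
        (subst (d ≤_) (trans (ℕ.+-suc _ t) (cong (λ l → suc (l ℕ.+ t)) (toℕ-inject₁ j))) d≤))
      (isInteger-* (c (suc j) , refl) (φℤ 0 z≤n)))

  -- By linearity top (Σ v_i γ^i x) = Σ v_i φ i x, which turns the pairing on ℤ[γ] into a dot
  -- product of integer vectors.
  top-horner : ∀ {n} (v : Vec ℤ n) (b : Fin n → ℤ) x → (∀ i → φ (toℕ i) x ≡ ℤ→ℚ (b i)) →
               top (horner n (ℤ→ℚ ∘ Vec.lookup v) x) ≡ ℤ→ℚ (dot v b)
  top-horner []      b x φ≡b = refl
  top-horner {suc n} (z ∷ v) b x φ≡b = begin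
    top (γ (horner n (ℤ→ℚ ∘ Vec.lookup v) x)) ℚ.+ ℤ→ℚ z ℚ.* top x
      ≡⟨ cong₂ (λ s t → s ℚ.+ ℤ→ℚ z ℚ.* t)
           (sym (horner-γ n (ℤ→ℚ ∘ Vec.lookup v) x (fromℕ d))) (φ≡b zero) ⟩
    top (horner n (ℤ→ℚ ∘ Vec.lookup v) (γ x)) ℚ.+ ℤ→ℚ z ℚ.* ℤ→ℚ (b zero)
      ≡⟨ cong₂ ℚ._+_ (top-horner v (b ∘ suc) (γ x) (φ≡b ∘ suc)) (sym (ℤ→ℚ-* z (b zero))) ⟩
    ℤ→ℚ (dot v (b ∘ suc)) ℚ.+ ℤ→ℚ (z * b zero)
      ≡⟨ ℚ.+-comm (ℤ→ℚ (dot v (b ∘ suc))) (ℤ→ℚ (z * b zero)) ⟩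
    ℤ→ℚ (z * b zero) ℚ.+ ℤ→ℚ (dot v (b ∘ suc))
      ≡⟨ ℤ→ℚ-+ (z * b zero) (dot v (b ∘ suc)) ⟨
    ℤ→ℚ (dot (z ∷ v) b) ∎

  -- `sumOver` consults the whole subset J at every index, so the induction runs over a tail I of
  -- it, with g embedding the remaining indices.
  φ-foldr : ∀ N i {k l} (I : Subset k) (J : Subset l) (g : Fin k → Fin l) (q : Fin l → K) (e : Fin k → ℤ) →
    (∀ s → Vec.lookup I s ≡ Vec.lookup J (g s)) → (∀ s → N ℚ.* φ i (q (g s)) ≡ ℤ→ℚ (e s)) →
    N ℚ.* φ i (foldr (λ s r → if Vec.lookup J s then addK (q s) r else r) zeroK (tabulate g))
    ≡ ℤ→ℚ (sumIn I e)
  φ-foldr N i []      J g q e I≡J φ≡e = trans (cong (N ℚ.*_) (φ-0 i)) (ℚ.*-zeroʳ N)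
  φ-foldr N i (a ∷ I) J g q e I≡J φ≡e with Vec.lookup J (g zero) | I≡J zero
  ... | outside | refl = φ-foldr N i I J (g ∘ suc) q (e ∘ suc) (I≡J ∘ suc) (φ≡e ∘ suc)
  ... | inside  | refl = begin
    N ℚ.* φ i (addK (q (g zero)) r)                  ≡⟨ cong (N ℚ.*_) (φ-+ i (q (g zero)) r) ⟩
    N ℚ.* (φ i (q (g zero)) ℚ.+ φ i r)               ≡⟨ ℚ.*-distribˡ-+ N (φ i (q (g zero))) (φ i r) ⟩
    N ℚ.* φ i (q (g zero)) ℚ.+ N ℚ.* φ i r
      ≡⟨ cong₂ ℚ._+_ (φ≡e zero) (φ-foldr N i I J (g ∘ suc) q (e ∘ suc) (I≡J ∘ suc) (φ≡e ∘ suc)) ⟩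
    ℤ→ℚ (e zero) ℚ.+ ℤ→ℚ (sumIn I (e ∘ suc))         ≡⟨ ℤ→ℚ-+ (e zero) (sumIn I (e ∘ suc)) ⟨
    ℤ→ℚ (e zero + sumIn I (e ∘ suc))                 ∎
    where r = foldr (λ s r → if Vec.lookup J s then addK (q s) r else r) zeroK (tabulate (g ∘ suc))

  φ-sumOver : ∀ N i (I : Subset k) (q : Fin k → K) (e : Fin k → ℤ) →
    (∀ s → N ℚ.* φ i (q s) ≡ ℤ→ℚ (e s)) → N ℚ.* φ i (sumOver I q) ≡ ℤ→ℚ (sumIn I e)
  φ-sumOver N i I q e = φ-foldr N i I I (λ s → s) q e (λ _ → refl)

-- Translation of a cover of O_K into congruences mod N

theorem1p2 : (d : ℕ) (c : Fin (suc d) → ℤ) → IsField c → PowerIntegralBasis c →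
    (m : ℕ) → 1 ≤ m → (k : ℕ) (α β ω : Fin k → Elem d) →
    (∀ s → IsAlgInt c (α s)) → (∀ s → IsAlgInt c (β s)) → (∀ s → ¬ (β s ≈K zeroK)) →
    IsMCover c m α β → (∀ s → IsAlgInt c (ω s)) →
    (q : Fin k → Elem d) → (∀ s → mulK c (β s) (q s) ≈K ω s) →
    (μ : Elem d) →
    Σ (Subset k) (λ I → InShiftedOK c μ (sumOver I q)) →
    Σ (Fin (2 ^ m) → Subset k)
    (λ F → Injective _≡_ _≡_ F × (∀ j → InShiftedOK c μ (sumOver (F j) q)))
theorem1p2 d c _ pib m _ k α β ω αint _ _ isCover ωint q βq≈ω μ (I₀ , w₀ , w₀int , sum≈μ+w₀)
  with common-denominator q
-- As g_{I₀} ∈ μ + O_K, the target coset is g_{I₀} + O_K, and it suffices to find subsets whose sums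
-- are congruent to that of I₀.
... | N , N≢0 , cleared = many-map m shifted (many-congruent N {{N≢0}} b A cover I₀)
  where
  instance _ = N≢0

  Q : Fin k → Elem d
  Q s = scaleK (ℤ→ℚ (+ N)) (q s)

  φQ-integer : ∀ s i → IsInteger (φ c i (Q s))
  φQ-integer s i = γ^-integer c i (cleared s) (fromℕ d)

  -- N times top (γ^i ω_s/β_s). For x with coordinate vector v, `dot v (b s)` mod N is thus the
  -- exponent of χ_x(ω_s/β_s).
  b : Fin k → Fin (suc d) → ℤ
  b s i = proj₁ (φQ-integer s (toℕ i))

  φQ≡b : ∀ s i → φ c (toℕ i) (Q s) ≡ ℤ→ℚ (b s i)
  φQ≡b s i = proj₂ (φQ-integer s (toℕ i))

  αQ-integer : ∀ s → IsInteger (top c (mulBy c (α s) (Q s)))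
  αQ-integer s = horner-integer c (suc d) (proj₁ (pib (α s)) (αint s)) (cleared s) (fromℕ d)

  -- N times top (α_s ω_s/β_s), the exponent of ζ_s.
  A : Fin k → ℤ
  A s = proj₁ (αQ-integer s)

  cover : ∀ v → Σ (Subset k) λ J → m ≤ ∣ J ∣ × (∀ s → s ∈ J → + N ∣ dot v (b s) - A s)
  cover v with isCover x (proj₂ (pib x) (λ i → Vec.lookup v i , refl))
    where
    x : Elem d
    x = ℤ→ℚ ∘ Vec.lookup v
  ... | J , m≤∣J∣ , inCoset = J , m≤∣J∣ , λ s s∈J → divides-coset s (inCoset s s∈J)
    where
    x : Elem d
    x = ℤ→ℚ ∘ Vec.lookup v

    -- If x = α_s + β_s w, then x ω_s/β_s = α_s ω_s/β_s + w ω_s with w ω_s ∈ ℤ[γ]. After scaling by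
    -- N, the difference is N times the integer top (w ω_s).
    divides-coset : ∀ s → InCoset c x (α s) (β s) → + N ∣ dot v (b s) - A s
    divides-coset s (w , wint , x≈α+βw) = divides (proj₁ wω) (ℤ→ℚ-injective (begin
      ℤ→ℚ (dot v (b s) - A s)
        ≡⟨ ℤ→ℚ-minus (dot v (b s)) (A s) ⟩
      ℤ→ℚ (dot v (b s)) ℚ.- ℤ→ℚ (A s)
        ≡⟨ cong₂ ℚ._-_ (top-horner c v (b s) (Q s) (φQ≡b s)) (proj₂ (αQ-integer s)) ⟨
      top c (mulBy c x (Q s)) ℚ.- top c (mulBy c (α s) (Q s))
        ≡⟨ cong (ℚ._- top c (mulBy c (α s) (Q s))) xQ ⟩
      top c (mulBy c (α s) (Q s)) ℚ.+ ℤ→ℚ (+ N) ℚ.* ℤ→ℚ (proj₁ wω) ℚ.- top c (mulBy c (α s) (Q s))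
        ≡⟨ solve 3 (λ a n z → (a :+ (n :* z)) :- a := z :* n) refl
             (top c (mulBy c (α s) (Q s))) (ℤ→ℚ (+ N)) (ℤ→ℚ (proj₁ wω)) ⟩
      ℤ→ℚ (proj₁ wω) ℚ.* ℤ→ℚ (+ N)
        ≡⟨ ℤ→ℚ-* (proj₁ wω) (+ N) ⟨
      ℤ→ℚ (proj₁ wω * + N) ∎))
      where
      wω : IsInteger (top c (mulBy c w (ω s)))
      wω = horner-integer c (suc d) (proj₁ (pib w) wint) (proj₁ (pib (ω s)) (ωint s)) (fromℕ d)

      βw = mulK c (β s) w

      βwq≈wω : ∀ i → mulBy c βw (q s) i ≡ mulBy c w (ω s) i
      βwq≈wω i = begin
        mulBy c βw (q s) i             ≡⟨ horner-congᵇ c (suc d) (q s) (mulK≈mulBy c (β s) w) i ⟩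
        mulBy c (mulBy c w (β s)) (q s) i  ≡⟨ mulBy-assoc c w (β s) (q s) i ⟩
        mulBy c w (mulBy c (β s) (q s)) i
          ≡⟨ horner-cong c (suc d) w (λ i → trans (mulBy-comm c (β s) (q s) i)
               (trans (sym (mulK≈mulBy c (β s) (q s) i)) (βq≈ω s i))) i ⟩
        mulBy c w (ω s) i              ∎

      xQ : top c (mulBy c x (Q s)) ≡ top c (mulBy c (α s) (Q s)) ℚ.+ ℤ→ℚ (+ N) ℚ.* ℤ→ℚ (proj₁ wω)
      xQ = begin
        top c (mulBy c x (Q s))
          ≡⟨ horner-congᵇ c (suc d) (Q s) x≈α+βw (fromℕ d) ⟩
        top c (mulBy c (addK (α s) βw) (Q s))
          ≡⟨ horner-+ᵇ c (suc d) (α s) βw (Q s) (fromℕ d) ⟩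
        top c (mulBy c (α s) (Q s)) ℚ.+ top c (mulBy c βw (Q s))
          ≡⟨ cong (top c (mulBy c (α s) (Q s)) ℚ.+_) (trans
               (horner-scale c (suc d) βw (ℤ→ℚ (+ N)) (q s) (fromℕ d))
               (cong (ℤ→ℚ (+ N) ℚ.*_) (trans (βwq≈wω (fromℕ d)) (proj₂ wω)))) ⟩
        top c (mulBy c (α s) (Q s)) ℚ.+ ℤ→ℚ (+ N) ℚ.* ℤ→ℚ (proj₁ wω) ∎

  Nφ-sumOver : ∀ I i → ℤ→ℚ (+ N) ℚ.* φ c (toℕ i) (sumOver I q) ≡ ℤ→ℚ (sumIn I (λ s → b s i))
  Nφ-sumOver I i = φ-sumOver c (ℤ→ℚ (+ N)) (toℕ i) I q (λ s → b s i)
    (λ s → trans (sym (φ-scale c (toℕ i) (ℤ→ℚ (+ N)) (q s))) (φQ≡b s i))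

  -- The congruences make φ i (g_I - g_{I₀}) an integer for all i ≤ d, so g_I - g_{I₀} lies in ℤ[γ]
  -- by perfectness of the pairing; adding it to w₀ gives the required element of O_K.
  shifted : ∀ I → (∀ i → + N ∣ sumIn I (λ s → b s i) - sumIn I₀ (λ s → b s i)) →
            InShiftedOK c μ (sumOver I q)
  shifted I N∣ = addK w₀ diff , proj₂ (pib _) (λ i → isInteger-+ (proj₁ (pib w₀) w₀int i) (diff-integer i)) ,
    λ i → trans
      (solve 2 (λ g g₀ → g := g₀ :+ (g :+ (con (ℚ.- 1ℚ) :* g₀))) refl
        (sumOver I q i) (sumOver I₀ q i))
      (trans (cong (ℚ._+ diff i) (sum≈μ+w₀ i)) (ℚ.+-assoc (μ i) (w₀ i) (diff i)))
    where
    diff : Elem d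
    diff = addK (sumOver I q) (scaleK (ℚ.- 1ℚ) (sumOver I₀ q))

    φdiff : ∀ i → IsInteger (φ c (toℕ i) diff)
    φdiff i with N∣ i
    ... | divides z eq = z , ℤ→ℚ-cancelˡ N (begin
      ν ℚ.* φ c (toℕ i) diff
        ≡⟨ cong (ν ℚ.*_) (trans (φ-+ c (toℕ i) (sumOver I q) (scaleK (ℚ.- 1ℚ) (sumOver I₀ q)))
             (cong (φ c (toℕ i) (sumOver I q) ℚ.+_) (φ-scale c (toℕ i) (ℚ.- 1ℚ) (sumOver I₀ q)))) ⟩
      ν ℚ.* (φ c (toℕ i) (sumOver I q) ℚ.+ (ℚ.- 1ℚ) ℚ.* φ c (toℕ i) (sumOver I₀ q))
        ≡⟨ solve 3 (λ n g g₀ → n :* (g :+ (con (ℚ.- 1ℚ) :* g₀)) := (n :* g) :- (n :* g₀)) refl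
             ν (φ c (toℕ i) (sumOver I q)) (φ c (toℕ i) (sumOver I₀ q)) ⟩
      ν ℚ.* φ c (toℕ i) (sumOver I q) ℚ.- ν ℚ.* φ c (toℕ i) (sumOver I₀ q)
        ≡⟨ cong₂ ℚ._-_ (Nφ-sumOver I i) (Nφ-sumOver I₀ i) ⟩
      ℤ→ℚ (sumIn I (λ s → b s i)) ℚ.- ℤ→ℚ (sumIn I₀ (λ s → b s i))
        ≡⟨ ℤ→ℚ-minus (sumIn I (λ s → b s i)) (sumIn I₀ (λ s → b s i)) ⟨
      ℤ→ℚ (sumIn I (λ s → b s i) - sumIn I₀ (λ s → b s i))
        ≡⟨ cong ℤ→ℚ (trans eq (ℤ.*-comm z (+ N))) ⟩
      ℤ→ℚ (+ N * z)
        ≡⟨ ℤ→ℚ-* (+ N) z ⟩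
      ν ℚ.* ℤ→ℚ z ∎)
      where ν = ℤ→ℚ (+ N)

    diff-integer : InZγ diff
    -- With t = d all d + 1 functionals are available, so the bound d ≤ j + t holds for every
    -- coordinate j.
    diff-integer j = φ-integer⇒integer c d diff
      (λ i i≤d → subst (λ l → IsInteger (φ c l diff)) (toℕ-fromℕ< (s≤s i≤d))
        (φdiff (Fin.fromℕ< (s≤s i≤d))))
      j (ℕ.m≤n+m d (toℕ j))
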